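{- On a two-letter alphabet, there exists a $2$-regular word of length $n\ge 1$ if and only if $n=4k$ for some integer $k\ge 2$.
   Context: For a word $u=u_1\cdots u_m$ over an alphabet $\mathcal A$ with $b$ letters and an integer $r\ge -1$, $u$ is $r$-regular if for every $k=0,1,\dots,r$ the sum $\sum_{1\le t\le m,\ u_t=c} t^k$ is the same for all letters $c\in\mathcal A$ (a letter not occurring contributes $0$). Here $b=2$. -}

module Defs where

open import Data.Nat using (ℕ; suc; _^_)
open import Data.Integer as ℤ using (ℤ; +_)
open import Data.Fin using (Fin; toℕ)
open import Data.Fin.Properties using (_≟_)
open import Data.Nat.ListAction using (sum)
open import Data.List using (map; filter; allFin)
open import Data.Vec using (Vec; lookup)
open import Relation.Binary.PropositionalEquality using (_≡_)

Word : ℕ → ℕ → Set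
Word b m = Vec (Fin b) m

-- Positions are numbered 1, …, m, so t : Fin m stands for position suc (toℕ t).
positionPowerSum : ∀ {b m} → ℕ → Word b m → Fin b → ℕ
positionPowerSum {m = m} k u c =
  sum (map (λ t → suc (toℕ t) ^ k) (filter (λ t → lookup u t ≟ c) (allFin m)))

-- r is an integer so that r = -1 (no condition at all) is included.
Regular : ∀ {b m} → ℤ → Word b m → Set
Regular {b} r u =
  ∀ (k : ℕ) → + k ℤ.≤ r → ∀ (c d : Fin b) → positionPowerSum k u c ≡ positionPowerSum k u d

-- Necessity: with S the common power sum, k = 0 gives n = 2 S₀ and k = 1 gives n (n + 1) = 4 S₁,
-- so 4 ∣ n; n = 4 fails since no subset of {1, 4, 9, 16} has sum 15.
-- Sufficiency: regularity is invariant under shifting positions, so regular words can be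
-- concatenated, and blocks of lengths 8 and 12 produce every length 4k with k ≥ 2.
module Submission where

open import Data.Nat as ℕ using (ℕ; zero; suc; _+_; _*_; _^_; _≤_; _≥_; z≤n; s≤s)
open import Data.Nat.Properties
  using (+-assoc; +-identityʳ; *-zeroʳ; *-distribˡ-+; *-cancelˡ-≡; ≤-trans)
  renaming (_≟_ to _≟ℕ_)
open import Data.Nat.Divisibility using (_∣_; divides; m∣m*n; ∣m+n∣m⇒∣n)
open import Data.Nat.ListAction using (sum)
open import Data.Nat.ListAction.Properties using (sum-++)
open import Data.Nat.Tactic.RingSolver using (solve-∀)
open import Data.Integer as ℤ using (+_; +≤+)
open import Data.Bool using (if_then_else_)
open import Data.Fin using (Fin; zero; suc; toℕ)
open import Data.Fin.Patterns using (0F; 1F; 2F)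
open import Data.Fin.Properties using (_≟_; all?)
open import Data.List as List using (List; []; _∷_; map; filter; tabulate; allFin; applyUpTo; [_])
open import Data.List.Properties using (map-∘; map-tabulate; applyUpTo-∷ʳ)
open import Data.Vec using ([]; _∷_; _++_; lookup)
open import Data.Product using (Σ; _×_; _,_)
open import Data.Empty using (⊥-elim)
open import Function using (_∘_; id)
open import Function.Bundles using (_⇔_; mk⇔)
open import Relation.Nullary using (Dec; does; yes; no)
open import Relation.Unary using (Pred; Decidable)
open import Level using (Level)
open import Relation.Nullary.Decidable using (¬?; from-yes)
open import Relation.Binary.PropositionalEquality
  using (_≡_; _≢_; refl; sym; trans; cong; cong₂; subst; module ≡-Reasoning)
open import Defs
open ≡-Reasoning

-- Weighted position sums by recursion on the word.

filter-map : ∀ {a b p : Level} {A : Set a} {B : Set b} {P : Pred B p}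
  (P? : Decidable P) (f : A → B) (xs : List A) →
  filter P? (map f xs) ≡ map f (filter (P? ∘ f) xs)
filter-map P? f [] = refl
filter-map P? f (x ∷ xs) with P? (f x)
... | yes _ = cong (f x ∷_) (filter-map P? f xs)
... | no  _ = filter-map P? f xs

-- The weight is an arbitrary function of the 0-based position, so dropping a letter or prepending a
-- block only changes the weight, and inductions on the word go through.
weightSum : ∀ {b m} → (ℕ → ℕ) → Word b m → Fin b → ℕ
weightSum f []      c = 0
weightSum f (x ∷ u) c = (if does (x ≟ c) then f 0 else 0) + weightSum (f ∘ suc) u c

sum-filter≡weightSum : ∀ {b m} (f : ℕ → ℕ) (u : Word b m) (c : Fin b) →
  sum (map (f ∘ toℕ) (filter (λ t → lookup u t ≟ c) (allFin m))) ≡ weightSum f u c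
sum-filter≡weightSum f [] c = refl
sum-filter≡weightSum {m = suc m} f (x ∷ u) c = lemma
  where
  tail : sum (map (f ∘ toℕ) (filter (λ t → lookup (x ∷ u) t ≟ c) (tabulate suc)))
         ≡ weightSum (f ∘ suc) u c
  tail = begin
    sum (map (f ∘ toℕ) (filter (λ t → lookup (x ∷ u) t ≟ c) (tabulate suc)))
      -- The positions behind the head are the positions of `u` under `suc`; moving `suc` out of the
      -- filter and into the weight exposes the induction hypothesis.
      ≡⟨ cong (sum ∘ map (f ∘ toℕ) ∘ filter (λ t → lookup (x ∷ u) t ≟ c)) (map-tabulate id suc) ⟨
    sum (map (f ∘ toℕ) (filter (λ t → lookup (x ∷ u) t ≟ c) (map suc (allFin m))))
      ≡⟨ cong (sum ∘ map (f ∘ toℕ)) (filter-map (λ t → lookup (x ∷ u) t ≟ c) suc (allFin m)) ⟩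
    sum (map (f ∘ toℕ) (map suc (filter (λ t → lookup u t ≟ c) (allFin m))))
      ≡⟨ cong sum (map-∘ (filter (λ t → lookup u t ≟ c) (allFin m))) ⟨
    sum (map (f ∘ suc ∘ toℕ) (filter (λ t → lookup u t ≟ c) (allFin m)))
      ≡⟨ sum-filter≡weightSum (f ∘ suc) u c ⟩
    weightSum (f ∘ suc) u c ∎

  lemma : sum (map (f ∘ toℕ) (filter (λ t → lookup (x ∷ u) t ≟ c) (allFin (suc m))))
          ≡ weightSum f (x ∷ u) c
  lemma with x ≟ c
  ... | yes _ = cong (f 0 ℕ.+_) tail
  ... | no  _ = tail

weightSum-cong : ∀ {b m} {f g : ℕ → ℕ} → (∀ t → f t ≡ g t) →
  (u : Word b m) (c : Fin b) → weightSum f u c ≡ weightSum g u c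
weightSum-cong f≗g []      c = refl
weightSum-cong f≗g (x ∷ u) c =
  cong₂ (λ w → (if does (x ≟ c) then w else 0) ℕ.+_) (f≗g 0) (weightSum-cong (f≗g ∘ suc) u c)

weightSum-+ : ∀ {b m} (f g : ℕ → ℕ) (u : Word b m) (c : Fin b) →
  weightSum (λ t → f t + g t) u c ≡ weightSum f u c + weightSum g u c
weightSum-+ f g []      c = refl
weightSum-+ f g (x ∷ u) c with x ≟ c
... | yes _ = trans (cong (f 0 + g 0 ℕ.+_) (weightSum-+ (f ∘ suc) (g ∘ suc) u c))
                    (interchange (f 0) (g 0) _ _)
  where
  interchange : ∀ a b c d → a + b + (c + d) ≡ a + c + (b + d)
  interchange = solve-∀
... | no  _ = weightSum-+ (f ∘ suc) (g ∘ suc) u c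

weightSum-* : ∀ {b m} (a : ℕ) (f : ℕ → ℕ) (u : Word b m) (c : Fin b) →
  weightSum (λ t → a * f t) u c ≡ a * weightSum f u c
weightSum-* a f []      c = sym (*-zeroʳ a)
weightSum-* a f (x ∷ u) c with x ≟ c
... | yes _ = trans (cong (a * f 0 ℕ.+_) (weightSum-* a (f ∘ suc) u c)) (sym (*-distribˡ-+ a (f 0) _))
... | no  _ = weightSum-* a (f ∘ suc) u c

weightSum-++ : ∀ {b m n} (f : ℕ → ℕ) (u : Word b m) (v : Word b n) (c : Fin b) →
  weightSum f (u ++ v) c ≡ weightSum f u c + weightSum (f ∘ (m ℕ.+_)) v c
weightSum-++ f []      v c = refl
weightSum-++ f (x ∷ u) v c =
  trans (cong ((if does (x ≟ c) then f 0 else 0) ℕ.+_) (weightSum-++ (f ∘ suc) u v c))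
        (sym (+-assoc (if does (x ≟ c) then f 0 else 0) _ _))

-- With two letters, each position is counted for exactly one of them.
weightSum-total : ∀ {m} (f : ℕ → ℕ) (u : Word 2 m) →
  weightSum f u 0F + weightSum f u 1F ≡ sum (applyUpTo f m)
weightSum-total f [] = refl
weightSum-total f (0F ∷ u) =
  trans (+-assoc (f 0) _ _) (cong (f 0 ℕ.+_) (weightSum-total (f ∘ suc) u))
weightSum-total f (1F ∷ u) =
  trans (swap (weightSum (f ∘ suc) u 0F) (f 0) _) (cong (f 0 ℕ.+_) (weightSum-total (f ∘ suc) u))
  where
  swap : ∀ a w b → a + (w + b) ≡ w + (a + b)
  swap = solve-∀

-- Necessity: divisibility by 4 and the excluded length 4.

sum-⟨1+t⟩^0 : ∀ n → sum (applyUpTo (λ t → suc t ^ 0) n) ≡ n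
sum-⟨1+t⟩^0 zero    = refl
sum-⟨1+t⟩^0 (suc n) = cong suc (sum-⟨1+t⟩^0 n)

2*sum-⟨1+t⟩^1 : ∀ n → 2 * sum (applyUpTo (λ t → suc t ^ 1) n) ≡ n * suc n
2*sum-⟨1+t⟩^1 zero    = refl
2*sum-⟨1+t⟩^1 (suc n) = begin
  -- `applyUpTo` unfolds at the front, which would change the summand; splitting off the last term
  -- keeps `f` fixed for the induction hypothesis.
  2 * sum (applyUpTo f (suc n))            ≡⟨ cong (λ l → 2 * sum l) (applyUpTo-∷ʳ f n) ⟨
  2 * sum (applyUpTo f n List.++ [ f n ]) ≡⟨ cong (2 *_) (sum-++ (applyUpTo f n) [ f n ]) ⟩
  2 * (sum (applyUpTo f n) + (f n + 0))    ≡⟨ distrib (sum (applyUpTo f n)) n ⟩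
  2 * sum (applyUpTo f n) + 2 * suc n      ≡⟨ cong (_+ 2 * suc n) (2*sum-⟨1+t⟩^1 n) ⟩
  n * suc n + 2 * suc n                    ≡⟨ factor n ⟩
  suc n * suc (suc n)                      ∎
  where
  f : ℕ → ℕ
  f t = suc t ^ 1
  distrib : ∀ a n → 2 * (a + (suc n * 1 + 0)) ≡ 2 * a + 2 * suc n
  distrib = solve-∀
  factor : ∀ n → n * suc n + 2 * suc n ≡ suc n * suc (suc n)
  factor = solve-∀

regular⇒double : ∀ {m r} (u : Word 2 m) → Regular r u → ∀ k → + k ℤ.≤ r →
  2 * positionPowerSum k u 0F ≡ sum (applyUpTo (λ t → suc t ^ k) m)
regular⇒double {m} u reg k k≤r = begin
  2 * positionPowerSum k u 0F
    ≡⟨ cong (positionPowerSum k u 0F ℕ.+_) (+-identityʳ _) ⟩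
  positionPowerSum k u 0F + positionPowerSum k u 0F
    ≡⟨ cong (positionPowerSum k u 0F ℕ.+_) (reg k k≤r 0F 1F) ⟩
  positionPowerSum k u 0F + positionPowerSum k u 1F
    ≡⟨ cong₂ _+_ (sum-filter≡weightSum f u 0F) (sum-filter≡weightSum f u 1F) ⟩
  weightSum f u 0F + weightSum f u 1F
    ≡⟨ weightSum-total f u ⟩
  sum (applyUpTo f m) ∎
  where
  f : ℕ → ℕ
  f t = suc t ^ k

-- Cancelling a factor 2 leaves `2 * s ≡ 2 * (m * m) + m`, where 2 divides all terms but the last.
2m⟨2m+1⟩≡4s⇒2∣m : ∀ m s → 2 * m * suc (2 * m) ≡ 2 * (2 * s) → 2 ∣ m
2m⟨2m+1⟩≡4s⇒2∣m m s eq = ∣m+n∣m⇒∣n (subst (2 ∣_) 2s≡2m²+m (m∣m*n s)) (m∣m*n (m * m))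
  where
  expand : ∀ m → 2 * m * suc (2 * m) ≡ 2 * (2 * (m * m) + m)
  expand = solve-∀
  2s≡2m²+m : 2 * s ≡ 2 * (m * m) + m
  2s≡2m²+m = *-cancelˡ-≡ _ _ 2 (trans (sym eq) (expand m))

regular₁⇒4∣n : ∀ {n} (u : Word 2 n) → Regular (+ 1) u → Σ ℕ λ k → n ≡ 4 * k
regular₁⇒4∣n {n} u reg with 2m⟨2m+1⟩≡4s⇒2∣m m s eq
  where
  m s : ℕ
  m = positionPowerSum 0 u 0F
  s = positionPowerSum 1 u 0F
  n≡2m : 2 * m ≡ n
  n≡2m = trans (regular⇒double u reg 0 (+≤+ z≤n)) (sum-⟨1+t⟩^0 n)
  eq : 2 * m * suc (2 * m) ≡ 2 * (2 * s)
  eq = begin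
    2 * m * suc (2 * m)                            ≡⟨ cong (λ l → l * suc l) n≡2m ⟩
    n * suc n                                      ≡⟨ 2*sum-⟨1+t⟩^1 n ⟨
    2 * sum (applyUpTo (λ t → suc t ^ 1) n)        ≡⟨ cong (2 *_) (regular⇒double u reg 1 (+≤+ (s≤s z≤n))) ⟨
    2 * (2 * s)                                    ∎
... | divides k m≡k*2 = k , (begin
  n                              ≡⟨ trans (regular⇒double u reg 0 (+≤+ z≤n)) (sum-⟨1+t⟩^0 n) ⟨
  2 * positionPowerSum 0 u 0F    ≡⟨ cong (2 *_) m≡k*2 ⟩
  2 * (k * 2)                    ≡⟨ regroup k ⟩
  4 * k                          ∎)
  where
  regroup : ∀ k → 2 * (k * 2) ≡ 4 * k
  regroup = solve-∀

-- Settled by evaluating a decision procedure on all 16 words; the word is split into letters so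
-- that `all?` can range over each of them.
squareSums-differ : (u : Word 2 4) → positionPowerSum 2 u 0F ≢ positionPowerSum 2 u 1F
squareSums-differ (a ∷ b ∷ c ∷ d ∷ []) = differ a b c d
  where
  Differ : (a b c d : Fin 2) → Set
  Differ a b c d = let u = a ∷ b ∷ c ∷ d ∷ [] in positionPowerSum 2 u 0F ≢ positionPowerSum 2 u 1F
  differ? : ∀ a b c d → Dec (Differ a b c d)
  differ? a b c d = ¬? (_ ≟ℕ _)
  differ : ∀ a b c d → Differ a b c d
  differ = from-yes (all? λ a → all? λ b → all? λ c → all? (differ? a b c))

regular₂⇒k≥2 : ∀ {n} → n ≥ 1 → (u : Word 2 n) → Regular (+ 2) u → ∀ k → n ≡ 4 * k → k ≥ 2
regular₂⇒k≥2 () u reg zero          refl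
-- Here `4 * 1` computes to 4, so `u` is a word of length 4.
regular₂⇒k≥2 _  u reg (suc zero)    refl =
  ⊥-elim (squareSums-differ u (reg 2 (+≤+ (s≤s (s≤s z≤n))) 0F 1F))
regular₂⇒k≥2 _  u reg (suc (suc k)) _    = s≤s (s≤s z≤n)

-- Sufficiency: shifting, concatenation and explicit blocks.

-- By the binomial expansion, a shifted moment is a combination of moments of order at most `k`
-- whose coefficients depend on `n` but not on the letter.
weightSum-shift : ∀ {b m} (n : ℕ) (u : Word b m) → Regular (+ 2) u → ∀ k → k ≤ 2 → (c d : Fin b) →
  weightSum (λ t → suc (n + t) ^ k) u c ≡ weightSum (λ t → suc (n + t) ^ k) u d
weightSum-shift {b} n u reg k k≤2 c d = shift k k≤2
  where
  moment : ℕ → Fin b → ℕ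
  moment k = weightSum (λ t → suc t ^ k) u

  moments-agree : ∀ k → k ≤ 2 → moment k c ≡ moment k d
  moments-agree k k≤2 = trans (sym (sum-filter≡weightSum (λ t → suc t ^ k) u c))
    (trans (reg k (+≤+ k≤2) c d) (sum-filter≡weightSum (λ t → suc t ^ k) u d))

  -- The ring solver rejects suc t ^ k, hence the unfolded powers.
  linear : ∀ n t → suc (n + t) * 1 ≡ suc t * 1 + n * 1
  linear = solve-∀

  -- The factor 1 in `n * 1` is `suc t ^ 0`, so `weightSum-*` yields a multiple of `moment 0`;
  -- likewise for `n * n * 1` below.
  expand₁ : ∀ c → weightSum (λ t → suc (n + t) ^ 1) u c ≡ moment 1 c + n * moment 0 c
  expand₁ c = trans (weightSum-cong (linear n) u c)
    (trans (weightSum-+ _ _ u c) (cong (moment 1 c ℕ.+_) (weightSum-* n _ u c)))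

  quadratic : ∀ n t → suc (n + t) * (suc (n + t) * 1)
                      ≡ suc t * (suc t * 1) + (2 * n * (suc t * 1) + n * n * 1)
  quadratic = solve-∀

  expand₂ : ∀ c → weightSum (λ t → suc (n + t) ^ 2) u c
                  ≡ moment 2 c + (2 * n * moment 1 c + n * n * moment 0 c)
  expand₂ c = trans (weightSum-cong (quadratic n) u c)
    (trans (weightSum-+ _ _ u c) (cong (moment 2 c ℕ.+_)
      (trans (weightSum-+ _ _ u c) (cong₂ _+_ (weightSum-* (2 * n) _ u c) (weightSum-* (n * n) _ u c)))))

  shift : ∀ k → k ≤ 2 → weightSum (λ t → suc (n + t) ^ k) u c ≡ weightSum (λ t → suc (n + t) ^ k) u d
  shift 0 _ = moments-agree 0 z≤n
  shift 1 _ = trans (expand₁ c) (trans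
    (cong₂ (λ x y → x + n * y) (moments-agree 1 (s≤s z≤n)) (moments-agree 0 z≤n))
    (sym (expand₁ d)))
  shift 2 _ = trans (expand₂ c) (trans
    (cong₂ _+_ (moments-agree 2 (s≤s (s≤s z≤n)))
      (cong₂ (λ x y → 2 * n * x + n * n * y) (moments-agree 1 (s≤s z≤n)) (moments-agree 0 z≤n)))
    (sym (expand₂ d)))
  shift (suc (suc (suc _))) (s≤s (s≤s ()))

-- In `u ++ v` the letters of `v` start at position `m + 1`, so their contribution is a moment of
-- `v` shifted by `m`.
regular₂-++ : ∀ {b m n} (u : Word b m) (v : Word b n) →
  Regular (+ 2) u → Regular (+ 2) v → Regular (+ 2) (u ++ v)
regular₂-++ {m = m} u v reg-u reg-v k (+≤+ k≤2) c d = begin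
  positionPowerSum k (u ++ v) c                    ≡⟨ split c ⟩
  positionPowerSum k u c + weightSum g v c         ≡⟨ cong₂ _+_ (reg-u k (+≤+ k≤2) c d)
                                                               (weightSum-shift m v reg-v k k≤2 c d) ⟩
  positionPowerSum k u d + weightSum g v d         ≡⟨ split d ⟨
  positionPowerSum k (u ++ v) d                    ∎
  where
  f g : ℕ → ℕ
  f t = suc t ^ k
  g t = suc (m + t) ^ k
  split : ∀ c → positionPowerSum k (u ++ v) c ≡ positionPowerSum k u c + weightSum g v c
  split c = trans (sum-filter≡weightSum f (u ++ v) c)
    (trans (weightSum-++ f u v c) (cong (ℕ._+ weightSum g v c) (sym (sum-filter≡weightSum f u c))))

-- Leaves three numerical equations, which hold by `refl` for a concrete word.
regular₂ : ∀ {m} (u : Word 2 m) →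
  (∀ (k : Fin 3) → positionPowerSum (toℕ k) u 0F ≡ positionPowerSum (toℕ k) u 1F) → Regular (+ 2) u
regular₂ u eq k (+≤+ k≤2) = λ
  { 0F 0F → refl
  ; 0F 1F → eq′ k k≤2
  ; 1F 0F → sym (eq′ k k≤2)
  ; 1F 1F → refl
  }
  where
  eq′ : ∀ k → k ≤ 2 → positionPowerSum k u 0F ≡ positionPowerSum k u 1F
  eq′ 0 _ = eq 0F
  eq′ 1 _ = eq 1F
  eq′ 2 _ = eq 2F
  eq′ (suc (suc (suc _))) (s≤s (s≤s ()))

-- The Thue-Morse prefix of length 8, Prouhet's solution: positions 1, 4, 6, 7 against 2, 3, 5, 8,
-- with sums 18 and square sums 102.
word₈ : Word 2 8
word₈ = 0F ∷ 1F ∷ 1F ∷ 0F ∷ 1F ∷ 0F ∷ 0F ∷ 1F ∷ []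

-- Positions 1, 3, 7, 8, 9, 11 against 2, 4, 5, 6, 10, 12, with sums 39 and square sums 325.
word₁₂ : Word 2 12
word₁₂ = 0F ∷ 1F ∷ 0F ∷ 1F ∷ 1F ∷ 1F ∷ 0F ∷ 0F ∷ 0F ∷ 1F ∷ 0F ∷ 1F ∷ []

word₈-regular : Regular (+ 2) word₈
word₈-regular = regular₂ word₈ λ { 0F → refl ; 1F → refl ; 2F → refl }

word₁₂-regular : Regular (+ 2) word₁₂
word₁₂-regular = regular₂ word₁₂ λ { 0F → refl ; 1F → refl ; 2F → refl }

-- Prepending `word₈` raises `k` by 2, hence one base case for each parity of `k`.
regularWord : ∀ k → Σ (Word 2 (4 * (2 + k))) (Regular (+ 2))
regularWord 0 = word₈ , word₈-regular
regularWord 1 = word₁₂ , word₁₂-regular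
regularWord (suc (suc k)) with regularWord k
... | u , reg = subst (λ n → Σ (Word 2 n) (Regular (+ 2))) (lengths k)
                      (word₈ ++ u , regular₂-++ word₈ u word₈-regular reg)
  where
  lengths : ∀ k → 8 + 4 * (2 + k) ≡ 4 * (2 + (2 + k))
  lengths = solve-∀

mainTheorem10 : (n : ℕ) → n ≥ 1 →
    (Σ (Word 2 n) λ u → Regular (+ 2) u) ⇔ (Σ ℕ λ k → k ≥ 2 × n ≡ 4 * k)
mainTheorem10 n n≥1 = mk⇔ constrain construct
  where
  constrain : (Σ (Word 2 n) λ u → Regular (+ 2) u) → Σ ℕ λ k → k ≥ 2 × n ≡ 4 * k
  constrain (u , reg) =
    -- A 2-regular word is 1-regular, since exponents up to 1 are also at most 2.
    let k , n≡4k = regular₁⇒4∣n u λ { k (+≤+ k≤1) → reg k (+≤+ (≤-trans k≤1 (s≤s z≤n))) }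
    in k , regular₂⇒k≥2 n≥1 u reg k n≡4k , n≡4k
  construct : (Σ ℕ λ k → k ≥ 2 × n ≡ 4 * k) → Σ (Word 2 n) λ u → Regular (+ 2) u
  construct (suc (suc k) , s≤s (s≤s z≤n) , refl) = regularWord k
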